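{- Consider the Normal Partizan Domination game on a star $K_{1,n}$ with $n\geq 2$, whose universal (center) vertex has color $A$, with $a$ leaves of color $A$ and $b=n-a$ leaves of color $B$. Its value is: $a-b$ if $b<a$; $1/2^{b-a+1}$ if $b\geq a\geq 1$; $(b-1)\cdot\uparrow *$ if $b$ is odd and $a=0$; $(b-1)\cdot\uparrow$ if $b$ is even and $a=0$. If instead the universal vertex has color $B$, the value is $-J$, where $J$ is the value of the game obtained by interchanging the colors $A$ and $B$ on all vertices.
   Context: Normal Partizan Domination game: a finite graph $G$ has each vertex colored $A$, $B$ or $C$. Alice and Bob alternately select a vertex; Alice may only select vertices colored $A$ or $C$, Bob only vertices colored $B$ or $C$. A vertex $u$ dominates $v$ if $u=v$ or $uv$ is an edge. A vertex may be selected only if it is playable, i.e. it dominates at least one vertex not dominated by the previously selected vertices; the game ends when the selected vertices form a dominating set. Under normal play the player unable to move loses. The game is regarded as a partizan combinatorial game with Alice as Left and Bob as Right, and its value is its value in Conway's combinatorial game theory ($\{X\mid Y\}$ has Left options $X$ and Right options $Y$; $G+H$ is the disjunctive sum; $-G$ swaps Left and Right; $G=H$ iff $G+(-H)$ is a second-player win). Notation: integers and dyadic rationals $1/2^k$ are the usual number games; $*=\{0\mid 0\}$; $\uparrow=\{0\mid *\}$; $m\cdot\uparrow$ is the sum of $m$ copies of $\uparrow$ (and $0\cdot\uparrow=0$); $J*$ denotes $J+*$. -}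

module Defs where

open import Data.Empty using (⊥)
open import Data.Fin using (Fin; zero; suc)
open import Data.Fin.Subset using (Subset; _∈_; _∪_; ⁅_⁆; _⊃_) renaming (⊥ to ∅)
open import Data.Fin.Subset.Induction using (Acc; acc; ⊃-wellFounded)
open import Data.Fin.Subset.Properties using (p⊆p∪q; q⊆p∪q; x∈⁅x⁆)
open import Data.Integer using (ℤ; +_; -[1+_])
open import Data.Nat using (ℕ; zero; suc)
open import Data.Product using (Σ; ∃-syntax; _×_; _,_)
open import Data.Sum using (_⊎_; [_,_])
open import Data.Unit using (⊤)
open import Data.Vec using (Vec; lookup; map)
open import Level using (0ℓ)
open import Relation.Binary using (Rel; Symmetric; Irreflexive; Decidable; DecidableEquality)
open import Relation.Binary.PropositionalEquality using (_≡_; refl)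
open import Relation.Nullary using (¬_; yes; no)

data Game : Set₁ where
  game : (L R : Set) → (L → Game) → (R → Game) → Game

infix  8 -ᴳ_
infixr 7 _·ᴳ_
infixl 6 _+ᴳ_
infix  4 _≈ᴳ_

-ᴳ_ : Game → Game
-ᴳ game L R l r = game R L (λ j → -ᴳ r j) (λ i → -ᴳ l i)

_+ᴳ_ : Game → Game → Game
G@(game L R l r) +ᴳ H@(game L′ R′ l′ r′) =
  game (L ⊎ L′) (R ⊎ R′)
    [ (λ i → l i +ᴳ H) , (λ i → G +ᴳ l′ i) ]
    [ (λ j → r j +ᴳ H) , (λ j → G +ᴳ r′ j) ]

-- A player with no option loses when due to move.
LeftWinsMovingFirst LeftWinsMovingSecond : Game → Set
LeftWinsMovingFirst  (game L R l r) = ∃[ i ] LeftWinsMovingSecond (l i)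
LeftWinsMovingSecond (game L R l r) = ∀ j → LeftWinsMovingFirst (r j)

RightWinsMovingFirst RightWinsMovingSecond : Game → Set
RightWinsMovingFirst  (game L R l r) = ∃[ j ] RightWinsMovingSecond (r j)
RightWinsMovingSecond (game L R l r) = ∀ i → RightWinsMovingFirst (l i)

SecondPlayerWins : Game → Set
SecondPlayerWins G = LeftWinsMovingSecond G × RightWinsMovingSecond G

_≈ᴳ_ : Game → Game → Set
G ≈ᴳ H = SecondPlayerWins (G +ᴳ (-ᴳ H))

0ᴳ : Game
0ᴳ = game ⊥ ⊥ (λ ()) (λ ())

⟨_∣_⟩ : Game → Game → Game
⟨ G ∣ H ⟩ = game ⊤ ⊤ (λ _ → G) (λ _ → H)

natᴳ : ℕ → Game
natᴳ zero    = 0ᴳ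
natᴳ (suc n) = game ⊤ ⊥ (λ _ → natᴳ n) (λ ())

intᴳ : ℤ → Game
intᴳ (+ n)    = natᴳ n
intᴳ -[1+ n ] = -ᴳ natᴳ (suc n)

-- The number 1/2^k, via 1/2^(k+1) = {0 ∣ 1/2^k}.
1/2^_ : ℕ → Game
1/2^ zero  = natᴳ 1
1/2^ suc k = ⟨ 0ᴳ ∣ 1/2^ k ⟩

⋆ : Game
⋆ = ⟨ 0ᴳ ∣ 0ᴳ ⟩

↑ : Game
↑ = ⟨ 0ᴳ ∣ ⋆ ⟩

_·ᴳ_ : ℕ → Game → Game
zero  ·ᴳ G = 0ᴳ
suc m ·ᴳ G = G +ᴳ m ·ᴳ G

record Graph : Set₁ where
  field
    order  : ℕ
    Adj    : Rel (Fin order) 0ℓ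
    adj?   : Decidable Adj
    sym    : Symmetric Adj
    irrefl : Irreflexive _≡_ Adj

-- Edges of K_{1,n}, with vertex zero as its center.
data StarAdj {n : ℕ} : Rel (Fin (suc n)) 0ℓ where
  center-leaf : ∀ i → StarAdj zero (suc i)
  leaf-center : ∀ i → StarAdj (suc i) zero

star : ℕ → Graph
star n = record
  { order  = suc n
  ; Adj    = StarAdj
  ; adj?   = λ { zero zero       → no λ ()
               ; zero (suc i)    → yes (center-leaf i)
               ; (suc i) zero    → yes (leaf-center i)
               ; (suc i) (suc j) → no λ () }
  ; sym    = λ { (center-leaf i) → leaf-center i
               ; (leaf-center i) → center-leaf i }
  ; irrefl = λ { refl () }
  }

data Color : Set where
  A B C : Color

_≟ᶜ_ : DecidableEquality Color
A ≟ᶜ A = yes refl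
A ≟ᶜ B = no λ ()
A ≟ᶜ C = no λ ()
B ≟ᶜ A = no λ ()
B ≟ᶜ B = yes refl
B ≟ᶜ C = no λ ()
C ≟ᶜ A = no λ ()
C ≟ᶜ B = no λ ()
C ≟ᶜ C = yes refl

swapColor : Color → Color
swapColor A = B
swapColor B = A
swapColor C = C

Coloring : Graph → Set
Coloring G = Vec Color (Graph.order G)

swapColors : (G : Graph) → Coloring G → Coloring G
swapColors G = map swapColor

data Player : Set where
  Alice Bob : Player

data _MaySelect_ : Player → Color → Set where
  Alice-A : Alice MaySelect A
  Alice-C : Alice MaySelect C
  Bob-B   : Bob MaySelect B
  Bob-C   : Bob MaySelect C

module PartizanDomination (G : Graph) (coloring : Coloring G) where
  open Graph G

  Vertex : Set
  Vertex = Fin order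

  Dominates : Vertex → Vertex → Set
  Dominates u v = u ≡ v ⊎ Adj u v

  DominatedBy : Subset order → Vertex → Set
  DominatedBy S v = ∃[ u ] u ∈ S × Dominates u v

  Playable : Subset order → Vertex → Set
  Playable S u = ∃[ v ] Dominates u v × ¬ DominatedBy S v

  Move : Player → Subset order → Set
  Move p S = Σ Vertex λ u → p MaySelect lookup coloring u × Playable S u

  playable⇒⊃ : ∀ {S u} → Playable S u → (S ∪ ⁅ u ⁆) ⊃ S
  playable⇒⊃ {S} {u} (v , u-dom-v , v-undominated) =
    p⊆p∪q ⁅ u ⁆ , u , q⊆p∪q S ⁅ u ⁆ (x∈⁅x⁆ u) , λ u∈S → v-undominated (u , u∈S , u-dom-v)

  -- The position in which S is the set of vertices selected so far. Once S is a
  -- dominating set no vertex is playable, so the end of the game needs no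
  -- separate clause.
  position : (S : Subset order) → Acc _⊃_ S → Game
  position S (acc rs) =
    game (Move Alice S) (Move Bob S)
      (λ (u , _ , u-playable) → position (S ∪ ⁅ u ⁆) (rs (playable⇒⊃ u-playable)))
      (λ (u , _ , u-playable) → position (S ∪ ⁅ u ⁆) (rs (playable⇒⊃ u-playable)))

dominationGame : (G : Graph) → Coloring G → Game
dominationGame G coloring = position ∅ (⊃-wellFounded ∅)
  where open PartizanDomination G coloring

{-# OPTIONS --safe #-}

-- As long as the center is unselected, only the numbers a and b of unselected leaves
-- of color A and B matter, also before the first move: the position is
-- S a b = { 0 , S (a-1) b ∣ S a (b-1) }, where the option 0 is Alice's move at the
-- center. For a ≥ 1 the values follow by induction on a and b, using for the left
-- option S 0 b that S 0 (b-1) ≤ 1/2^b. For a = 0 one has S 0 (b+2) = ↑ + ⋆ + S 0 (b+1):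
-- after every move in the difference of the two sides there is a reply to a position
-- controlled by S 0 b ≤ S 0 (b+2) , S 0 (b+3) and ⋆ + S 0 (b+1) ≤ S 0 (b+2) , S 0 (b+3).
-- Hence S 0 (b+1) = b·↑ + (b+1)·⋆.
module Submission where

open import Defs
open import Algebra.Bundles using (CommutativeMonoid)
import Algebra.Properties.CommutativeSemigroup as CommutativeSemigroupProperties
open import Data.Bool using (true; false; if_then_else_)
open import Data.Fin using (zero; suc)
open import Data.Fin.Subset using (Subset; inside; outside; _∉_; _∪_; ⁅_⁆) renaming (⊥ to ∅)
open import Data.Fin.Subset.Induction using (acc; ⊃-wellFounded)
open import Data.Fin.Subset.Properties using (∪-identityʳ; drop-there)
open import Data.Integer using (_⊖_)
open import Data.Integer.Properties using (⊖-≥)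
open import Data.Nat using (ℕ; zero; suc; _+_; _∸_; _≤_; _<_; z≤n; s≤s; z<s)
open import Data.Nat.Divisibility using (_∣_; _∤_; _∣0; ∣-refl; ∣⇒≤; ∣m+n∣m⇒∣n; ∣m∣n⇒∣m+n)
open import Data.Nat.Properties
  using (+-comm; +-suc; suc-injective; ≤-reflexive; <⇒≤; ≤⇒≯; m∸n+n≡m; m<n⇒0<n∸m; m≤n⇒m≤1+n)
open import Data.Product using (∃-syntax; _×_; _,_; proj₁; proj₂; swap)
open import Data.Sum using (_⊎_; inj₁; inj₂; [_,_])
open import Data.Unit using (tt)
open import Data.Vec using (Vec; []; _∷_; count; lookup; here; there)
open import Data.Vec.Properties using (lookup-map)
open import Function using (id; _∘_)
open import Level using (0ℓ) renaming (suc to lsuc)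
open import Relation.Binary.PropositionalEquality using (_≡_; _≢_; refl; sym; trans; cong; subst; subst₂)
open import Relation.Nullary using (¬_; yes; no; does; contradiction)

-- Options of a game, Conway's order and the induced equality.

LeftMove RightMove : Game → Set
LeftMove  (game L _ _ _) = L
RightMove (game _ R _ _) = R

infix 9 _ᴸ_ _ᴿ_

_ᴸ_ : ∀ G → LeftMove G → Game
game _ _ l _ ᴸ i = l i

_ᴿ_ : ∀ G → RightMove G → Game
game _ _ _ r ᴿ j = r j

infix 4 _≤ᴳ_ _⧏_ _≋_

-- Conway's order and its companion "less than or confused with". The usual
-- definition of the latter as a negation is replaced by an explicit winning move.
mutual
  record _≤ᴳ_ (G H : Game) : Set where
    inductive
    constructor ≤ᴳ-intro
    field
      left  : ∀ i → G ᴸ i ⧏ H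
      right : ∀ j → G ⧏ H ᴿ j

  data _⧏_ (G H : Game) : Set where
    viaLeft  : ∀ i → G ≤ᴳ H ᴸ i → G ⧏ H
    viaRight : ∀ j → G ᴿ j ≤ᴳ H → G ⧏ H

_≋_ : Game → Game → Set
G ≋ H = G ≤ᴳ H × H ≤ᴳ G

≤ᴳ-refl : ∀ {G} → G ≤ᴳ G
≤ᴳ-refl {game _ _ l r} = ≤ᴳ-intro (λ i → viaLeft i (≤ᴳ-refl {l i})) (λ j → viaRight j (≤ᴳ-refl {r j}))

mutual
  -- Composing `_≤ᴳ_` with `_⧏_` follows the explicit winning move: in an outer game it leads back
  -- to `≤ᴳ-trans`, in the middle game it replaces that game by an option.
  ≤ᴳ-trans : ∀ {G H K} → G ≤ᴳ H → H ≤ᴳ K → G ≤ᴳ K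
  ≤ᴳ-trans p@(≤ᴳ-intro l _) q@(≤ᴳ-intro _ r) =
    ≤ᴳ-intro (λ i → ⧏-≤ᴳ-trans (l i) q) (λ j → ≤ᴳ-⧏-trans p (r j))

  ⧏-≤ᴳ-trans : ∀ {G H K} → G ⧏ H → H ≤ᴳ K → G ⧏ K
  ⧏-≤ᴳ-trans (viaLeft i p)  (≤ᴳ-intro l _) = ≤ᴳ-⧏-trans p (l i)
  ⧏-≤ᴳ-trans (viaRight j p) q              = viaRight j (≤ᴳ-trans p q)

  ≤ᴳ-⧏-trans : ∀ {G H K} → G ≤ᴳ H → H ⧏ K → G ⧏ K
  ≤ᴳ-⧏-trans p              (viaLeft i q)  = viaLeft i (≤ᴳ-trans p q)
  ≤ᴳ-⧏-trans (≤ᴳ-intro _ r) (viaRight j q) = ⧏-≤ᴳ-trans (r j) q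

≋-refl : ∀ {G} → G ≋ G
≋-refl = ≤ᴳ-refl , ≤ᴳ-refl

≋-sym : ∀ {G H} → G ≋ H → H ≋ G
≋-sym = swap

≋-trans : ∀ {G H K} → G ≋ H → H ≋ K → G ≋ K
≋-trans (p , p′) (q , q′) = ≤ᴳ-trans p q , ≤ᴳ-trans q′ p′

-- The equal partner of an option is a winning reply to it. The monoid laws and the translation of
-- domination positions into star games rest on this matching.
≋-intro : ∀ {G H} →
  (∀ i → ∃[ i′ ] G ᴸ i ≋ H ᴸ i′) → (∀ i′ → ∃[ i ] G ᴸ i ≋ H ᴸ i′) →
  (∀ j → ∃[ j′ ] G ᴿ j ≋ H ᴿ j′) → (∀ j′ → ∃[ j ] G ᴿ j ≋ H ᴿ j′) →
  G ≋ H
≋-intro l l′ r r′ =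
  ≤ᴳ-intro (λ i → let i′ , p = l i in viaLeft i′ (proj₁ p))
           (λ j′ → let j , p = r′ j′ in viaRight j (proj₁ p)) ,
  ≤ᴳ-intro (λ i′ → let i , p = l′ i′ in viaLeft i (proj₂ p))
           (λ j → let j′ , p = r j in viaRight j′ (proj₂ p))

-- Games under disjunctive sum as an ordered commutative monoid.

+ᴳ-comm : ∀ G H → G +ᴳ H ≋ H +ᴳ G
+ᴳ-comm G@(game L R l r) H@(game L′ R′ l′ r′) = ≋-intro
  [ (λ i → inj₂ i , +ᴳ-comm (l i) H) , (λ i → inj₁ i , +ᴳ-comm G (l′ i)) ]
  [ (λ i → inj₂ i , +ᴳ-comm G (l′ i)) , (λ i → inj₁ i , +ᴳ-comm (l i) H) ]
  [ (λ j → inj₂ j , +ᴳ-comm (r j) H) , (λ j → inj₁ j , +ᴳ-comm G (r′ j)) ]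
  [ (λ j → inj₂ j , +ᴳ-comm G (r′ j)) , (λ j → inj₁ j , +ᴳ-comm (r j) H) ]

+ᴳ-identityʳ : ∀ G → G +ᴳ 0ᴳ ≋ G
+ᴳ-identityʳ (game L R l r) = ≋-intro
  [ (λ i → i , +ᴳ-identityʳ (l i)) , (λ ()) ]
  (λ i → inj₁ i , +ᴳ-identityʳ (l i))
  [ (λ j → j , +ᴳ-identityʳ (r j)) , (λ ()) ]
  (λ j → inj₁ j , +ᴳ-identityʳ (r j))

+ᴳ-identityˡ : ∀ G → 0ᴳ +ᴳ G ≋ G
+ᴳ-identityˡ G = ≋-trans (+ᴳ-comm 0ᴳ G) (+ᴳ-identityʳ G)

+ᴳ-assoc : ∀ G H K → (G +ᴳ H) +ᴳ K ≋ G +ᴳ (H +ᴳ K)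
+ᴳ-assoc G@(game L R l r) H@(game L′ R′ l′ r′) K@(game L″ R″ l″ r″) = ≋-intro
  [ [ (λ i → inj₁ i , +ᴳ-assoc (l i) H K)
    , (λ i → inj₂ (inj₁ i) , +ᴳ-assoc G (l′ i) K) ]
  , (λ i → inj₂ (inj₂ i) , +ᴳ-assoc G H (l″ i)) ]
  [ (λ i → inj₁ (inj₁ i) , +ᴳ-assoc (l i) H K)
  , [ (λ i → inj₁ (inj₂ i) , +ᴳ-assoc G (l′ i) K)
    , (λ i → inj₂ i , +ᴳ-assoc G H (l″ i)) ] ]
  [ [ (λ j → inj₁ j , +ᴳ-assoc (r j) H K)
    , (λ j → inj₂ (inj₁ j) , +ᴳ-assoc G (r′ j) K) ]
  , (λ j → inj₂ (inj₂ j) , +ᴳ-assoc G H (r″ j)) ]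
  [ (λ j → inj₁ (inj₁ j) , +ᴳ-assoc (r j) H K)
  , [ (λ j → inj₁ (inj₂ j) , +ᴳ-assoc G (r′ j) K)
    , (λ j → inj₂ j , +ᴳ-assoc G H (r″ j)) ] ]

mutual
  -- A move in one copy of `K` is answered by the same move in the other copy, a move in `G` or `H`
  -- by the reply that the hypothesis supplies.
  +ᴳ-monoˡ-≤ᴳ : ∀ {G H} K → G ≤ᴳ H → G +ᴳ K ≤ᴳ H +ᴳ K
  +ᴳ-monoˡ-≤ᴳ {game _ _ _ _} {game _ _ _ _} K@(game _ _ l″ r″) p@(≤ᴳ-intro l r) = ≤ᴳ-intro
    [ (λ i → +ᴳ-monoˡ-⧏ K (l i)) , (λ i → viaLeft (inj₂ i) (+ᴳ-monoˡ-≤ᴳ (l″ i) p)) ]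
    [ (λ j → +ᴳ-monoˡ-⧏ K (r j)) , (λ j → viaRight (inj₂ j) (+ᴳ-monoˡ-≤ᴳ (r″ j) p)) ]

  +ᴳ-monoˡ-⧏ : ∀ {G H} K → G ⧏ H → G +ᴳ K ⧏ H +ᴳ K
  +ᴳ-monoˡ-⧏ {game _ _ _ _} {game _ _ _ _} K@(game _ _ _ _) (viaLeft i p)  = viaLeft (inj₁ i) (+ᴳ-monoˡ-≤ᴳ K p)
  +ᴳ-monoˡ-⧏ {game _ _ _ _} {game _ _ _ _} K@(game _ _ _ _) (viaRight j p) = viaRight (inj₁ j) (+ᴳ-monoˡ-≤ᴳ K p)

+ᴳ-mono-≤ᴳ : ∀ {G G′ H H′} → G ≤ᴳ G′ → H ≤ᴳ H′ → G +ᴳ H ≤ᴳ G′ +ᴳ H′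
+ᴳ-mono-≤ᴳ {G} {G′} {H} {H′} p q =
  ≤ᴳ-trans (+ᴳ-monoˡ-≤ᴳ H p)
    (≤ᴳ-trans (proj₁ (+ᴳ-comm G′ H))
      (≤ᴳ-trans (+ᴳ-monoˡ-≤ᴳ G′ q) (proj₁ (+ᴳ-comm H′ G′))))

+ᴳ-cong : ∀ {G G′ H H′} → G ≋ G′ → H ≋ H′ → G +ᴳ H ≋ G′ +ᴳ H′
+ᴳ-cong (p , p′) (q , q′) = +ᴳ-mono-≤ᴳ p q , +ᴳ-mono-≤ᴳ p′ q′

+ᴳ-0ᴳ-commutativeMonoid : CommutativeMonoid (lsuc 0ℓ) 0ℓ
+ᴳ-0ᴳ-commutativeMonoid = record
  { Carrier = Game ; _≈_ = _≋_ ; _∙_ = _+ᴳ_ ; ε = 0ᴳ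
  ; isCommutativeMonoid = record
    { isMonoid = record
      { isSemigroup = record
        { isMagma = record
          { isEquivalence = record { refl = ≋-refl ; sym = ≋-sym ; trans = ≋-trans }
          ; ∙-cong = +ᴳ-cong }
        ; assoc = +ᴳ-assoc }
      ; identity = +ᴳ-identityˡ , +ᴳ-identityʳ }
    ; comm = +ᴳ-comm } }

open CommutativeSemigroupProperties
  (CommutativeMonoid.commutativeSemigroup +ᴳ-0ᴳ-commutativeMonoid)
  using (interchange)

-- From the order to the outcome of a difference.

mutual
  -- Left's moves in `G +ᴳ -ᴳ H` are the Left options of `G` and the Right options of `H`, one field
  -- of `_≤ᴳ_` for each; a proof of `_⧏_` names Right's winning reply.
  ≤ᴳ⇒RightWinsMovingSecond : ∀ {G H} → G ≤ᴳ H → RightWinsMovingSecond (G +ᴳ -ᴳ H)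
  ≤ᴳ⇒RightWinsMovingSecond {game _ _ _ _} {game _ _ _ _} (≤ᴳ-intro l _) (inj₁ i) = ⧏⇒RightWinsMovingFirst (l i)
  ≤ᴳ⇒RightWinsMovingSecond {game _ _ _ _} {game _ _ _ _} (≤ᴳ-intro _ r) (inj₂ j) = ⧏⇒RightWinsMovingFirst (r j)

  ⧏⇒RightWinsMovingFirst : ∀ {G H} → G ⧏ H → RightWinsMovingFirst (G +ᴳ -ᴳ H)
  ⧏⇒RightWinsMovingFirst {game _ _ _ _} {game _ _ _ _} (viaLeft i p)  = inj₂ i , ≤ᴳ⇒RightWinsMovingSecond p
  ⧏⇒RightWinsMovingFirst {game _ _ _ _} {game _ _ _ _} (viaRight j p) = inj₁ j , ≤ᴳ⇒RightWinsMovingSecond p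

mutual
  ≥ᴳ⇒LeftWinsMovingSecond : ∀ {G H} → H ≤ᴳ G → LeftWinsMovingSecond (G +ᴳ -ᴳ H)
  ≥ᴳ⇒LeftWinsMovingSecond {game _ _ _ _} {game _ _ _ _} (≤ᴳ-intro _ r) (inj₁ j) = ⧐⇒LeftWinsMovingFirst (r j)
  ≥ᴳ⇒LeftWinsMovingSecond {game _ _ _ _} {game _ _ _ _} (≤ᴳ-intro l _) (inj₂ i) = ⧐⇒LeftWinsMovingFirst (l i)

  ⧐⇒LeftWinsMovingFirst : ∀ {G H} → H ⧏ G → LeftWinsMovingFirst (G +ᴳ -ᴳ H)
  ⧐⇒LeftWinsMovingFirst {game _ _ _ _} {game _ _ _ _} (viaLeft i p)  = inj₁ i , ≥ᴳ⇒LeftWinsMovingSecond p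
  ⧐⇒LeftWinsMovingFirst {game _ _ _ _} {game _ _ _ _} (viaRight j p) = inj₂ j , ≥ᴳ⇒LeftWinsMovingSecond p

≋⇒≈ᴳ : ∀ {G H} → G ≋ H → G ≈ᴳ H
≋⇒≈ᴳ (p , q) = ≥ᴳ⇒LeftWinsMovingSecond q , ≤ᴳ⇒RightWinsMovingSecond p

-- Basic inequalities and multiples of `⋆`.

0≤ᴳG⇒H≤ᴳG+H : ∀ {G} H → 0ᴳ ≤ᴳ G → H ≤ᴳ G +ᴳ H
0≤ᴳG⇒H≤ᴳG+H H p = ≤ᴳ-trans (proj₂ (+ᴳ-identityˡ H)) (+ᴳ-monoˡ-≤ᴳ H p)

G≤ᴳ0⇒G+H≤ᴳH : ∀ {G} H → G ≤ᴳ 0ᴳ → G +ᴳ H ≤ᴳ H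
G≤ᴳ0⇒G+H≤ᴳH H p = ≤ᴳ-trans (+ᴳ-monoˡ-≤ᴳ H p) (proj₁ (+ᴳ-identityˡ H))

⋆+⋆≋0 : ⋆ +ᴳ ⋆ ≋ 0ᴳ
⋆+⋆≋0 =
  ≤ᴳ-intro [ (λ _ → viaRight (inj₂ tt) 0+0≤0) , (λ _ → viaRight (inj₁ tt) 0+0≤0) ] (λ ()) ,
  ≤ᴳ-intro (λ ()) [ (λ _ → viaLeft (inj₂ tt) 0≤0+0) , (λ _ → viaLeft (inj₁ tt) 0≤0+0) ]
  where
  0+0≤0 = proj₁ (+ᴳ-identityʳ 0ᴳ)
  0≤0+0 = proj₂ (+ᴳ-identityʳ 0ᴳ)

0≤↑ : 0ᴳ ≤ᴳ ↑
0≤↑ = ≤ᴳ-intro (λ ()) (λ _ → viaLeft tt ≤ᴳ-refl)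

0≤nat : ∀ m → 0ᴳ ≤ᴳ natᴳ m
0≤nat zero    = ≤ᴳ-refl
0≤nat (suc m) = ≤ᴳ-intro (λ ()) (λ ())

-- Stars cancel in pairs, so the induction goes in steps of two, which keep the parity.
n·⋆ : ∀ n → (2 ∣ n → n ·ᴳ ⋆ ≋ 0ᴳ) × (2 ∤ n → n ·ᴳ ⋆ ≋ ⋆)
n·⋆ zero          = (λ _ → ≋-refl) , (λ 2∤0 → contradiction (2 ∣0) 2∤0)
n·⋆ (suc zero)    = (λ 2∣1 → contradiction (∣⇒≤ 2∣1) λ { (s≤s ()) }) , (λ _ → +ᴳ-identityʳ ⋆)
n·⋆ (suc (suc n)) =
  (λ 2∣2+n → ≋-trans drop (even (∣m+n∣m⇒∣n 2∣2+n ∣-refl))) ,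
  (λ 2∤2+n → ≋-trans drop (odd (2∤2+n ∘ ∣m∣n⇒∣m+n ∣-refl)))
  where
  even = proj₁ (n·⋆ n)
  odd  = proj₂ (n·⋆ n)
  drop : ⋆ +ᴳ (⋆ +ᴳ n ·ᴳ ⋆) ≋ n ·ᴳ ⋆
  drop = ≋-trans (≋-sym (+ᴳ-assoc ⋆ ⋆ (n ·ᴳ ⋆)))
           (≋-trans (+ᴳ-cong ⋆+⋆≋0 ≋-refl) (+ᴳ-identityˡ (n ·ᴳ ⋆)))

-- The star game in terms of leaf counts.

data AliceMove : ℕ → ℕ → Set where
  -- While a leaf is unselected, the center is playable because it dominates that leaf. Once all
  -- leaves of a star with at least one leaf are selected, every vertex is dominated.
  center : ∀ {a b} → 0 < a + b → AliceMove a b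
  leaf   : ∀ {a b} → AliceMove (suc a) b

data BobMove : ℕ → ℕ → Set where
  leaf : ∀ {a b} → BobMove a (suc b)

-- Alice owns the center, and a and b count the leaves of color A and B that are
-- still unselected.
mutual
  starGame : ℕ → ℕ → Game
  starGame a b = game (AliceMove a b) (BobMove a b) (afterAlice a b) (afterBob a b)

  afterAlice : ∀ a b → AliceMove a b → Game
  afterAlice a       b (center _) = 0ᴳ
  afterAlice (suc a) b leaf       = starGame a b

  afterBob : ∀ a b → BobMove a b → Game
  afterBob a (suc b) leaf = starGame a b

starGame-0-0 : starGame 0 0 ≋ 0ᴳ
starGame-0-0 = ≋-intro (λ { (center ()) }) (λ ()) (λ ()) (λ ())

starGame-0-1 : starGame 0 1 ≋ ⋆
starGame-0-1 = ≋-intro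
  (λ { (center _) → tt , ≋-refl }) (λ _ → center z<s , ≋-refl)
  (λ { leaf → tt , starGame-0-0 }) (λ _ → leaf , starGame-0-0)

0⧏starGame : ∀ {a b} → 0 < a + b → 0ᴳ ⧏ starGame a b
0⧏starGame 0<a+b = viaLeft (center 0<a+b) ≤ᴳ-refl

-- This and the next three lemmas specialize `≤ᴳ-intro` to star games: `p` treats Alice's center
-- move to 0, `q` the leaf move of the player concerned, and `l` or `r` the moves in `V`.
starGame≤ᴳ : ∀ {a b V} → 0ᴳ ⧏ V → starGame a b ⧏ V →
  (∀ j → starGame (suc a) b ⧏ V ᴿ j) → starGame (suc a) b ≤ᴳ V
starGame≤ᴳ p q r = ≤ᴳ-intro (λ { (center _) → p ; leaf → q }) r

starGame-0≤ᴳ : ∀ {b V} → 0ᴳ ⧏ V → (∀ j → starGame 0 b ⧏ V ᴿ j) → starGame 0 b ≤ᴳ V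
starGame-0≤ᴳ p r = ≤ᴳ-intro (λ { (center _) → p }) r

≤ᴳstarGame : ∀ {a b V} → (∀ i → V ᴸ i ⧏ starGame a (suc b)) → V ⧏ starGame a b →
  V ≤ᴳ starGame a (suc b)
≤ᴳstarGame l q = ≤ᴳ-intro l (λ { leaf → q })

≤ᴳstarGame-0 : ∀ {a V} → (∀ i → V ᴸ i ⧏ starGame a 0) → V ≤ᴳ starGame a 0
≤ᴳstarGame-0 l = ≤ᴳ-intro l (λ ())

-- Bob answers a move in the number by taking a leaf, so exponent and leaf count drop together.
starGame-0≤1/2^ : ∀ b → starGame 0 b ≤ᴳ 1/2^ (suc b)
starGame-0≤1/2^ zero    = ≤ᴳ-intro (λ { (center ()) }) (λ _ → viaLeft tt (proj₁ starGame-0-0))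
starGame-0≤1/2^ (suc b) =
  starGame-0≤ᴳ (viaLeft tt ≤ᴳ-refl) (λ _ → viaRight leaf (starGame-0≤1/2^ b))

-- Values with at least one leaf of color A.

mutual
  -- Here `suc m` is the surplus of A leaves; an equation in place of a subtraction lets the
  -- recursion shift it. A leaf of Alice lowers the surplus by one, a leaf of Bob raises it by one.
  starGame-nat : ∀ a b m → a ≡ suc m + b → starGame a b ≋ natᴳ (suc m)
  starGame-nat (suc a) b m eq =
    starGame≤ᴳ (viaLeft tt (0≤nat m)) (starGame⧏nat a b m (suc-injective eq)) (λ ()) ,
    nat≤starGame a b m (suc-injective eq)

  starGame⧏nat : ∀ a b m → a ≡ m + b → starGame a b ⧏ natᴳ (suc m)
  starGame⧏nat zero    zero    zero    _    = viaLeft tt (proj₁ starGame-0-0)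
  -- The counts are equal, so the value is 1/2, whose Right option is 1.
  starGame⧏nat (suc a) b       zero    refl =
    ≤ᴳ-⧏-trans (proj₁ (starGame-1/2^ a b 0 refl)) (viaRight tt ≤ᴳ-refl)
  starGame⧏nat a       b       (suc m) eq   = viaLeft tt (proj₁ (starGame-nat a b m eq))

  nat⧏starGame : ∀ a b m → a ≡ m + b → natᴳ m ⧏ starGame (suc a) b
  nat⧏starGame a b zero    eq = 0⧏starGame z<s
  nat⧏starGame a b (suc m) eq = viaLeft leaf (proj₂ (starGame-nat a b m eq))

  nat≤starGame : ∀ a b m → a ≡ m + b → natᴳ (suc m) ≤ᴳ starGame (suc a) b
  nat≤starGame a zero    m eq = ≤ᴳstarGame-0 (λ _ → nat⧏starGame a zero m eq)
  nat≤starGame a (suc b) m eq = ≤ᴳstarGame (λ _ → nat⧏starGame a (suc b) m eq)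
    -- Bob's leaf move leaves the value `m + 2`, which has `m + 1` as its Left option.
    (⧏-≤ᴳ-trans (viaLeft tt ≤ᴳ-refl)
      (proj₂ (starGame-nat (suc a) b (suc m) (cong suc (trans eq (+-suc m b))))))

  -- The center move and Bob's leaf move give the options of {0 | 1/2^k}. Alice's leaf move is a
  -- further Left option, harmless because it is `⧏` the claimed value.
  starGame-1/2^ : ∀ a b k → b ≡ k + suc a → starGame (suc a) b ≋ 1/2^ (suc k)
  starGame-1/2^ a zero    k eq = contradiction (trans eq (+-suc k a)) λ ()
  starGame-1/2^ a (suc b) k eq =
    starGame≤ᴳ (viaLeft tt ≤ᴳ-refl) (starGame⧏1/2^ a (suc b) k eq)
      (λ _ → viaRight leaf (proj₁ (starGame-1/2^-right a b k eq))) ,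
    ≤ᴳstarGame (λ _ → 0⧏starGame z<s) (viaRight tt (proj₂ (starGame-1/2^-right a b k eq)))

  starGame⧏1/2^ : ∀ a b k → b ≡ k + suc a → starGame a b ⧏ 1/2^ (suc k)
  -- Now `b` is `k + 1`, and Bob's leaf move leaves `k` leaves of color B.
  starGame⧏1/2^ zero    b k eq rewrite eq | +-comm k 1 = viaRight leaf (starGame-0≤1/2^ k)
  starGame⧏1/2^ (suc a) b k eq =
    ≤ᴳ-⧏-trans (proj₁ (starGame-1/2^ a b (suc k) (trans eq (+-suc k (suc a)))))
      (viaRight tt ≤ᴳ-refl)

  -- At exponent 0 the counts differ by one in Alice's favor, so the integer case takes over.
  starGame-1/2^-right : ∀ a b k → suc b ≡ k + suc a → starGame (suc a) b ≋ 1/2^ k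
  starGame-1/2^-right a b zero    eq = starGame-nat (suc a) b zero (sym eq)
  starGame-1/2^-right a b (suc k) eq = starGame-1/2^ a b k (suc-injective eq)

-- Stars all of whose leaves have color B.

0≤starGame-0 : ∀ b → 0ᴳ ≤ᴳ starGame 0 (2 + b)
0≤starGame-0 b = ≤ᴳstarGame (λ ()) (0⧏starGame z<s)

-- A leaf taken in the larger star is answered by one in the smaller, down to a comparison with 0.
-- An offset of one already fails between `starGame 0 0` and `starGame 0 1`, that is, between 0 and
-- `⋆`.
starGame-0-≤-2+ : ∀ b → starGame 0 b ≤ᴳ starGame 0 (2 + b)
starGame-0-≤-2+ zero    = ≤ᴳ-trans (proj₁ starGame-0-0) (0≤starGame-0 0)
starGame-0-≤-2+ (suc b) =
  starGame-0≤ᴳ (0⧏starGame z<s) (λ { leaf → viaRight leaf (starGame-0-≤-2+ b) })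

starGame-0-≤-3+ : ∀ b → starGame 0 b ≤ᴳ starGame 0 (3 + b)
starGame-0-≤-3+ zero    = ≤ᴳ-trans (proj₁ starGame-0-0) (0≤starGame-0 1)
starGame-0-≤-3+ (suc b) =
  starGame-0≤ᴳ (0⧏starGame z<s) (λ { leaf → viaRight leaf (starGame-0-≤-3+ b) })

⋆+0⧏starGame-0 : ∀ b → ⋆ +ᴳ 0ᴳ ⧏ starGame 0 (2 + b)
⋆+0⧏starGame-0 b =
  viaRight (inj₁ tt) (≤ᴳ-trans (proj₁ (+ᴳ-identityʳ 0ᴳ)) (0≤starGame-0 b))

⋆+starGame-0-1≤0 : ⋆ +ᴳ starGame 0 1 ≤ᴳ 0ᴳ
⋆+starGame-0-1≤0 = ≤ᴳ-trans (+ᴳ-mono-≤ᴳ ≤ᴳ-refl (proj₁ starGame-0-1)) (proj₁ ⋆+⋆≋0)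

-- The summand `⋆` makes up for the offset of one: a leaf taken in the larger star is answered by
-- moving `⋆` to 0, which leaves equal games.
⋆+starGame-0-≤-1+ : ∀ b → ⋆ +ᴳ starGame 0 (suc b) ≤ᴳ starGame 0 (2 + b)
⋆+starGame-0-≤-1+ b = ≤ᴳ-intro
  (λ { (inj₁ tt)         → viaRight (inj₂ leaf) (≤ᴳ-trans (proj₁ (+ᴳ-identityˡ _)) (starGame-0-≤-2+ b))
     ; (inj₂ (center _)) → ⋆+0⧏starGame-0 b })
  (λ { leaf → viaRight (inj₁ tt) (proj₁ (+ᴳ-identityˡ _)) })

⋆+starGame-0-≤-2+ : ∀ b → ⋆ +ᴳ starGame 0 (suc b) ≤ᴳ starGame 0 (3 + b)
⋆+starGame-0-≤-2+ b = ≤ᴳ-intro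
  (λ { (inj₁ tt)         → viaRight (inj₂ leaf) (≤ᴳ-trans (proj₁ (+ᴳ-identityˡ _)) (starGame-0-≤-3+ b))
     ; (inj₂ (center _)) → ⋆+0⧏starGame-0 (suc b) })
  (λ { leaf → bobReplies b })
  where
  bobReplies : ∀ b → ⋆ +ᴳ starGame 0 (suc b) ⧏ starGame 0 (2 + b)
  -- Here `starGame 0 1` is `⋆` and cancels the other star, so the center move to 0 in the larger
  -- star is a reply.
  bobReplies zero    = viaLeft (center z<s) ⋆+starGame-0-1≤0
  bobReplies (suc b) = viaRight (inj₂ leaf) (⋆+starGame-0-≤-2+ b)

-- Every move in a summand of the right side is answered by a leaf on the left: `↑` moved to `⋆`
-- makes the stars cancel, `⋆` moved to 0 leaves the nonnegative `↑`, and a leaf leads to the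
-- recursion.
starGame-0-2+≤ : ∀ b → starGame 0 (2 + b) ≤ᴳ (↑ +ᴳ ⋆) +ᴳ starGame 0 (suc b)
starGame-0-2+≤ b = starGame-0≤ᴳ (0⧏sum b)
  λ { (inj₁ (inj₁ tt)) → viaRight leaf (0≤ᴳG⇒H≤ᴳG+H _ (proj₂ ⋆+⋆≋0))
    ; (inj₁ (inj₂ tt)) → viaRight leaf (0≤ᴳG⇒H≤ᴳG+H _ 0≤↑+0)
    ; (inj₂ leaf)      → viaRight leaf (afterLeaf b) }
  where
  0≤↑+0 : 0ᴳ ≤ᴳ ↑ +ᴳ 0ᴳ
  0≤↑+0 = ≤ᴳ-trans 0≤↑ (proj₂ (+ᴳ-identityʳ ↑))

  0⧏sum : ∀ b → 0ᴳ ⧏ (↑ +ᴳ ⋆) +ᴳ starGame 0 (suc b)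
  -- Moving `↑` to 0 leaves `⋆` plus `starGame 0 1`, which is 0.
  0⧏sum zero    = viaLeft (inj₁ (inj₁ tt))
    (≤ᴳ-trans (proj₂ ⋆+⋆≋0) (+ᴳ-mono-≤ᴳ (proj₂ (+ᴳ-identityˡ ⋆)) (proj₂ starGame-0-1)))
  0⧏sum (suc b) = viaLeft (inj₁ (inj₂ tt)) (≤ᴳ-trans (0≤starGame-0 b) (0≤ᴳG⇒H≤ᴳG+H _ 0≤↑+0))

  afterLeaf : ∀ b → starGame 0 (suc b) ≤ᴳ (↑ +ᴳ ⋆) +ᴳ starGame 0 b
  afterLeaf zero    = ≤ᴳ-trans (proj₁ starGame-0-1) (≤ᴳ-trans (0≤ᴳG⇒H≤ᴳG+H ⋆ 0≤↑)
    (≤ᴳ-trans (proj₂ (+ᴳ-identityʳ _)) (+ᴳ-mono-≤ᴳ ≤ᴳ-refl (proj₂ starGame-0-0))))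
  afterLeaf (suc b) = starGame-0-2+≤ b

-- The standard reply moves `↑` to `⋆`, either cancelling the `⋆` present or replacing one just used
-- up. Only the move of `↑` to 0 removes this reply and is treated by `after↑`.
starGame-0-2+≥ : ∀ b → (↑ +ᴳ ⋆) +ᴳ starGame 0 (suc b) ≤ᴳ starGame 0 (2 + b)
starGame-0-2+≥ b = ≤ᴳstarGame
  (λ { (inj₁ (inj₁ tt))  → after↑ b
     ; (inj₁ (inj₂ tt))  → viaRight (inj₁ (inj₁ tt))
         (≤ᴳ-trans (+ᴳ-monoˡ-≤ᴳ _ (proj₁ (+ᴳ-identityʳ ⋆))) (⋆+starGame-0-≤-1+ b))
     ; (inj₂ (center _)) → viaRight (inj₁ (inj₁ tt))
         (≤ᴳ-trans (G≤ᴳ0⇒G+H≤ᴳH 0ᴳ (proj₁ ⋆+⋆≋0)) (0≤starGame-0 b)) })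
  (viaRight (inj₁ (inj₁ tt)) (G≤ᴳ0⇒G+H≤ᴳH _ (proj₁ ⋆+⋆≋0)))
  where
  0+⋆ = proj₁ (+ᴳ-identityˡ ⋆)

  after↑ : ∀ b → (0ᴳ +ᴳ ⋆) +ᴳ starGame 0 (suc b) ⧏ starGame 0 (2 + b)
  after↑ zero    = viaLeft (center z<s) (≤ᴳ-trans (+ᴳ-monoˡ-≤ᴳ _ 0+⋆) ⋆+starGame-0-1≤0)
  after↑ (suc b) = viaRight (inj₂ leaf) (≤ᴳ-trans (+ᴳ-monoˡ-≤ᴳ _ 0+⋆) (⋆+starGame-0-≤-2+ b))

-- The first leaf contributes `⋆` and each further one `↑ +ᴳ ⋆`; `interchange` collects the arrows
-- and the stars, whose parity is settled afterwards.
starGame-0-suc : ∀ b → starGame 0 (suc b) ≋ b ·ᴳ ↑ +ᴳ suc b ·ᴳ ⋆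
starGame-0-suc zero    = ≋-trans starGame-0-1
  (≋-trans (≋-sym (+ᴳ-identityʳ ⋆)) (≋-sym (+ᴳ-identityˡ (⋆ +ᴳ 0ᴳ))))
starGame-0-suc (suc b) = ≋-trans (starGame-0-2+≤ b , starGame-0-2+≥ b)
  (≋-trans (+ᴳ-cong ≋-refl (starGame-0-suc b)) (interchange ↑ ⋆ (b ·ᴳ ↑) (suc b ·ᴳ ⋆)))

-- The four closed forms.

starGame-b<a : ∀ {a b} → b < a → starGame a b ≋ intᴳ (a ⊖ b)
starGame-b<a {a} {b} b<a rewrite ⊖-≥ (<⇒≤ b<a) with a ∸ b | m<n⇒0<n∸m b<a | m∸n+n≡m (<⇒≤ b<a)
... | suc m | _ | eq = starGame-nat a b m (sym eq)

starGame-1≤a≤b : ∀ {a b} → a ≤ b → 1 ≤ a → starGame a b ≋ 1/2^ ((b ∸ a) + 1)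
starGame-1≤a≤b {suc a} {b} a≤b _ rewrite +-comm (b ∸ suc a) 1 =
  starGame-1/2^ a b (b ∸ suc a) (sym (m∸n+n≡m a≤b))

starGame-odd : ∀ {a b} → 2 ∤ b → a ≡ 0 → starGame a b ≋ ((b ∸ 1) ·ᴳ ↑) +ᴳ ⋆
starGame-odd {b = zero}  2∤0 refl = contradiction (2 ∣0) 2∤0
starGame-odd {b = suc b} 2∤b refl =
  ≋-trans (starGame-0-suc b) (+ᴳ-cong ≋-refl (proj₂ (n·⋆ (suc b)) 2∤b))

starGame-even : ∀ {a b} → 2 ∣ b → a ≡ 0 → starGame a b ≋ (b ∸ 1) ·ᴳ ↑
-- Truncated subtraction gives `0 ∸ 1 = 0`, so the stated value is 0.
starGame-even {b = zero}  _   refl = starGame-0-0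
starGame-even {b = suc b} 2∣b refl = ≋-trans (starGame-0-suc b)
  (≋-trans (+ᴳ-cong ≋-refl (proj₁ (n·⋆ (suc b)) 2∣b)) (+ᴳ-identityʳ (b ·ᴳ ↑)))

-- Counting unselected leaves of a given color.

unselected : ∀ {n} → Color → Vec Color n → Subset n → ℕ
unselected c []       []            = 0
unselected c (x ∷ xs) (inside ∷ S)  = unselected c xs S
unselected c (x ∷ xs) (outside ∷ S) = (if does (x ≟ᶜ c) then suc else id) (unselected c xs S)

unselected-∅ : ∀ {n} c (xs : Vec Color n) → unselected c xs ∅ ≡ count (_≟ᶜ c) xs
unselected-∅ c []       = refl
unselected-∅ c (x ∷ xs) with does (x ≟ᶜ c)
... | true  = cong suc (unselected-∅ c xs)
... | false = unselected-∅ c xs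

unselected-∪-∈ : ∀ {n} c (xs : Vec Color n) {S u} → u ∉ S → lookup xs u ≡ c →
  unselected c xs S ≡ suc (unselected c xs (S ∪ ⁅ u ⁆))
unselected-∪-∈ c (x ∷ xs) {inside ∷ S}  {zero}  u∉S _    = contradiction here u∉S
unselected-∪-∈ c (x ∷ xs) {outside ∷ S} {zero}  _   refl
  rewrite ∪-identityʳ S with c ≟ᶜ c
... | yes _  = refl
... | no c≢c = contradiction refl c≢c
unselected-∪-∈ c (x ∷ xs) {inside ∷ S}  {suc u} u∉S eq   = unselected-∪-∈ c xs (u∉S ∘ there) eq
unselected-∪-∈ c (x ∷ xs) {outside ∷ S} {suc u} u∉S eq   with does (x ≟ᶜ c)
... | true  = cong suc (unselected-∪-∈ c xs (u∉S ∘ there) eq)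
... | false = unselected-∪-∈ c xs (u∉S ∘ there) eq

unselected-∪-∉ : ∀ {n} c (xs : Vec Color n) {S u} → lookup xs u ≢ c →
  unselected c xs (S ∪ ⁅ u ⁆) ≡ unselected c xs S
unselected-∪-∉ c (x ∷ xs) {inside ∷ S}  {zero}  _   = cong (unselected c xs) (∪-identityʳ S)
unselected-∪-∉ c (x ∷ xs) {outside ∷ S} {zero}  x≢c rewrite ∪-identityʳ S with x ≟ᶜ c
... | yes x≡c = contradiction x≡c x≢c
... | no _    = refl
unselected-∪-∉ c (x ∷ xs) {inside ∷ S}  {suc u} x≢c = unselected-∪-∉ c xs x≢c
unselected-∪-∉ c (x ∷ xs) {outside ∷ S} {suc u} x≢c =
  cong (if does (x ≟ᶜ c) then suc else id) (unselected-∪-∉ c xs x≢c)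

0<unselected⇒∃ : ∀ {n} c (xs : Vec Color n) S → 0 < unselected c xs S →
  ∃[ u ] u ∉ S × lookup xs u ≡ c
0<unselected⇒∃ c []       []            ()
0<unselected⇒∃ c (x ∷ xs) (inside ∷ S)  0<k =
  let u , u∉S , eq = 0<unselected⇒∃ c xs S 0<k in suc u , u∉S ∘ drop-there , eq
0<unselected⇒∃ c (x ∷ xs) (outside ∷ S) 0<k with x ≟ᶜ c
... | yes x≡c = zero , (λ ()) , x≡c
... | no _    =
  let u , u∉S , eq = 0<unselected⇒∃ c xs S 0<k in suc u , u∉S ∘ drop-there , eq

countA+countB≤n : ∀ {n} (xs : Vec Color n) → count (_≟ᶜ A) xs + count (_≟ᶜ B) xs ≤ n
countA+countB≤n []       = z≤n
countA+countB≤n (A ∷ xs) = s≤s (countA+countB≤n xs)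
countA+countB≤n (B ∷ xs) rewrite +-suc (count (_≟ᶜ A) xs) (count (_≟ᶜ B) xs) = s≤s (countA+countB≤n xs)
countA+countB≤n (C ∷ xs) = m≤n⇒m≤1+n (countA+countB≤n xs)

-- A leaf of color C enters neither count, so the total would fall short of `n`.
countA+countB≡n⇒A⊎B : ∀ {n} (xs : Vec Color n) → count (_≟ᶜ A) xs + count (_≟ᶜ B) xs ≡ n →
  ∀ u → lookup xs u ≡ A ⊎ lookup xs u ≡ B
countA+countB≡n⇒A⊎B (A ∷ xs) _  zero    = inj₁ refl
countA+countB≡n⇒A⊎B (B ∷ xs) _  zero    = inj₂ refl
countA+countB≡n⇒A⊎B (A ∷ xs) eq (suc u) = countA+countB≡n⇒A⊎B xs (suc-injective eq) u
countA+countB≡n⇒A⊎B (B ∷ xs) eq (suc u) =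
  countA+countB≡n⇒A⊎B xs (suc-injective (trans (sym (+-suc (count (_≟ᶜ A) xs) _)) eq)) u
countA+countB≡n⇒A⊎B (C ∷ xs) eq _       = contradiction (≤-reflexive (sym eq)) (≤⇒≯ (countA+countB≤n xs))

-- Domination positions on a star as star games.

module StarPositions {n} (leaves : Vec Color (suc n))
  (A⊎B : ∀ u → lookup leaves u ≡ A ⊎ lookup leaves u ≡ B) where

  open PartizanDomination (star (suc n)) (A ∷ leaves)

  position-inside : ∀ S rs → position (inside ∷ S) rs ≋ 0ᴳ
  position-inside S (acc rs) = ≋-intro
    (λ (_ , _ , v , _ , v-undominated) → contradiction (dominated v) v-undominated) (λ ())
    (λ (_ , _ , v , _ , v-undominated) → contradiction (dominated v) v-undominated) (λ ())
    where
    dominated : ∀ v → DominatedBy (inside ∷ S) v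
    dominated zero    = zero , here , inj₁ refl
    dominated (suc v) = zero , here , inj₂ (center-leaf v)

  module _ {S : Subset (suc n)} where

    -- Only the leaf itself and the center dominate a leaf, and the center is `outside`.
    Playable-leaf : ∀ {u} → u ∉ S → Playable (outside ∷ S) (suc u)
    Playable-leaf {u} u∉S = suc u , inj₁ refl , undominated
      where
      undominated : ¬ DominatedBy (outside ∷ S) (suc u)
      undominated (suc _ , there u∈S , inj₁ refl) = u∉S u∈S

    Playable-leaf⁻¹ : ∀ {u} → Playable (outside ∷ S) (suc u) → u ∉ S
    Playable-leaf⁻¹ {u} (_ , dom , v-undominated) u∈S = v-undominated (suc u , there u∈S , dom)

    Playable-center : ∀ {u} → u ∉ S → Playable (outside ∷ S) zero
    Playable-center {u} u∉S = suc u , inj₂ (center-leaf u) , proj₂ (proj₂ (Playable-leaf u∉S))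

    Playable-center⁻¹ : Playable (outside ∷ S) zero → ∃[ u ] u ∉ S
    -- If the center is undominated, then no leaf is selected; leaf `zero` exists because there are
    -- `suc n` leaves.
    Playable-center⁻¹ (zero  , _ , v-undominated) =
      zero , λ 0∈S → v-undominated (suc zero , there 0∈S , inj₂ (leaf-center zero))
    Playable-center⁻¹ (suc v , _ , v-undominated) =
      v , λ v∈S → v-undominated (suc v , there v∈S , inj₁ refl)

    someUnselected : ∀ {u} → u ∉ S → 0 < unselected A leaves S + unselected B leaves S
    someUnselected {u} u∉S with A⊎B u
    ... | inj₁ u≡A rewrite unselected-∪-∈ A leaves u∉S u≡A = z<s
    ... | inj₂ u≡B rewrite unselected-∪-∈ B leaves u∉S u≡B
                         | +-suc (unselected A leaves S) (unselected B leaves (S ∪ ⁅ u ⁆)) = z<s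

    someUnselected⁻¹ : 0 < unselected A leaves S + unselected B leaves S → ∃[ u ] u ∉ S
    someUnselected⁻¹ 0<k with unselected A leaves S in eqA
    ... | suc _ = let u , u∉S , _ = 0<unselected⇒∃ A leaves S (subst (0 <_) (sym eqA) z<s) in u , u∉S
    ... | zero  = let u , u∉S , _ = 0<unselected⇒∃ B leaves S 0<k in u , u∉S

  -- Moves are matched in both directions, by recursion on the accessibility proof. Equations for
  -- the counts allow `a` and `b` to be refined to successors.
  position≋starGame : ∀ S rs {a b} → unselected A leaves S ≡ a → unselected B leaves S ≡ b →
    position (outside ∷ S) rs ≋ starGame a b
  position≋starGame S (acc rs) {a} {b} eqA eqB = ≋-intro aliceTo aliceFrom bobTo bobFrom
    where
    afterA : ∀ {u} r → u ∉ S → lookup leaves u ≡ A → ∀ {a} → unselected A leaves S ≡ suc a →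
      position (outside ∷ (S ∪ ⁅ u ⁆)) (rs r) ≋ starGame a b
    afterA {u} r u∉S u≡A eq = position≋starGame (S ∪ ⁅ u ⁆) (rs r)
      (suc-injective (trans (sym (unselected-∪-∈ A leaves u∉S u≡A)) eq))
      (trans (unselected-∪-∉ B leaves (λ u≡B → contradiction (trans (sym u≡A) u≡B) λ ())) eqB)

    afterB : ∀ {u} r → u ∉ S → lookup leaves u ≡ B → ∀ {b} → unselected B leaves S ≡ suc b →
      position (outside ∷ (S ∪ ⁅ u ⁆)) (rs r) ≋ starGame a b
    afterB {u} r u∉S u≡B eq = position≋starGame (S ∪ ⁅ u ⁆) (rs r)
      (trans (unselected-∪-∉ A leaves (λ u≡A → contradiction (trans (sym u≡A) u≡B) λ ())) eqA)
      (suc-injective (trans (sym (unselected-∪-∈ B leaves u∉S u≡B)) eq))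

    aliceTo : (m : Move Alice (outside ∷ S)) →
      ∃[ m′ ] position (outside ∷ S) (acc rs) ᴸ m ≋ starGame a b ᴸ m′
    aliceTo (zero  , _ , playable) =
      center (subst₂ (λ a b → 0 < a + b) eqA eqB (someUnselected (proj₂ (Playable-center⁻¹ playable)))) ,
      position-inside _ _
    aliceTo (suc u , may , playable) with A⊎B u
    ... | inj₂ u≡B = contradiction (subst (Alice MaySelect_) u≡B may) λ ()
    -- Selecting `u` lowers the count of A leaves by one, so `a` is a successor and the constructor
    -- `leaf` applies.
    ... | inj₁ u≡A with trans (sym eqA) (unselected-∪-∈ A leaves (Playable-leaf⁻¹ playable) u≡A)
    ...   | refl = leaf , afterA _ (Playable-leaf⁻¹ playable) u≡A eqA

    aliceFrom : ∀ m′ → ∃[ m ] position (outside ∷ S) (acc rs) ᴸ m ≋ starGame a b ᴸ m′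
    aliceFrom (center 0<a+b) =
      let _ , u∉S = someUnselected⁻¹ (subst₂ (λ a b → 0 < a + b) (sym eqA) (sym eqB) 0<a+b)
      in (zero , Alice-A , Playable-center u∉S) , position-inside _ _
    aliceFrom leaf =
      let u , u∉S , u≡A = 0<unselected⇒∃ A leaves S (subst (0 <_) (sym eqA) z<s)
      in (suc u , subst (Alice MaySelect_) (sym u≡A) Alice-A , Playable-leaf u∉S) ,
         afterA _ u∉S u≡A eqA

    bobTo : (m : Move Bob (outside ∷ S)) →
      ∃[ m′ ] position (outside ∷ S) (acc rs) ᴿ m ≋ starGame a b ᴿ m′
    bobTo (suc u , may , playable) with A⊎B u
    ... | inj₁ u≡A = contradiction (subst (Bob MaySelect_) u≡A may) λ ()
    ... | inj₂ u≡B with trans (sym eqB) (unselected-∪-∈ B leaves (Playable-leaf⁻¹ playable) u≡B)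
    ...   | refl = leaf , afterB _ (Playable-leaf⁻¹ playable) u≡B eqB

    bobFrom : ∀ m′ → ∃[ m ] position (outside ∷ S) (acc rs) ᴿ m ≋ starGame a b ᴿ m′
    bobFrom leaf =
      let u , u∉S , u≡B = 0<unselected⇒∃ B leaves S (subst (0 <_) (sym eqB) z<s)
      in (suc u , subst (Bob MaySelect_) (sym u≡B) Bob-B , Playable-leaf u∉S) ,
         afterB _ u∉S u≡B eqB

dominationGame≋starGame : ∀ {n} (leaves : Vec Color (suc n)) →
  count (_≟ᶜ A) leaves + count (_≟ᶜ B) leaves ≡ suc n →
  dominationGame (star (suc n)) (A ∷ leaves) ≋ starGame (count (_≟ᶜ A) leaves) (count (_≟ᶜ B) leaves)
dominationGame≋starGame leaves eq =
  StarPositions.position≋starGame leaves (countA+countB≡n⇒A⊎B leaves eq) ∅ (⊃-wellFounded ∅)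
    (unselected-∅ A leaves) (unselected-∅ B leaves)

-- Swapping the colors negates the game.

opponent : Player → Player
opponent Alice = Bob
opponent Bob   = Alice

MaySelect-swap : ∀ {p c} → p MaySelect c → opponent p MaySelect swapColor c
MaySelect-swap Alice-A = Bob-B
MaySelect-swap Alice-C = Bob-C
MaySelect-swap Bob-B   = Alice-A
MaySelect-swap Bob-C   = Alice-C

MaySelect-swap⁻¹ : ∀ {p} c → p MaySelect swapColor c → opponent p MaySelect c
MaySelect-swap⁻¹ A Bob-B   = Alice-A
MaySelect-swap⁻¹ B Alice-A = Bob-B
MaySelect-swap⁻¹ C Alice-C = Bob-C
MaySelect-swap⁻¹ C Bob-C   = Alice-C

module _ (G : Graph) (coloring : Coloring G) where

  private
    module D  = PartizanDomination G coloring
    module D′ = PartizanDomination G (swapColors G coloring)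

    toSwapped : ∀ {p S} → D.Move p S → D′.Move (opponent p) S
    toSwapped {p} (u , may , playable) =
      u , subst (opponent p MaySelect_) (sym (lookup-map u swapColor coloring)) (MaySelect-swap may) ,
      playable

    fromSwapped : ∀ {p S} → D′.Move p S → D.Move (opponent p) S
    fromSwapped {p} (u , may , playable) =
      u , MaySelect-swap⁻¹ _ (subst (p MaySelect_) (lookup-map u swapColor coloring) may) ,
      playable

  -- Playability ignores colors, so each move is matched with the opponent's move at the same
  -- vertex. Two independent accessibility proofs spare any comparison between them.
  position-swapColors : ∀ S rs rs′ → D.position S rs ≋ -ᴳ D′.position S rs′
  position-swapColors S (acc rs) (acc rs′) = ≋-intro
    (λ m → toSwapped m   , position-swapColors _ (rs _) (rs′ _))
    (λ m → fromSwapped m , position-swapColors _ (rs _) (rs′ _))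
    (λ m → toSwapped m   , position-swapColors _ (rs _) (rs′ _))
    (λ m → fromSwapped m , position-swapColors _ (rs _) (rs′ _))

  dominationGame-swapColors : dominationGame G coloring ≋ -ᴳ dominationGame G (swapColors G coloring)
  dominationGame-swapColors = position-swapColors ∅ (⊃-wellFounded ∅) (⊃-wellFounded ∅)

theorem6 : (n : ℕ) → 2 ≤ n →
    (a b : ℕ) → a + b ≡ n →
    (leaves : Vec Color n) → count (_≟ᶜ A) leaves ≡ a → count (_≟ᶜ B) leaves ≡ b →
    ((b < a → dominationGame (star n) (A ∷ leaves) ≈ᴳ intᴳ (a ⊖ b))
    × (a ≤ b → 1 ≤ a → dominationGame (star n) (A ∷ leaves) ≈ᴳ 1/2^ ((b ∸ a) + 1))
    × (2 ∤ b → a ≡ 0 → dominationGame (star n) (A ∷ leaves) ≈ᴳ ((b ∸ 1) ·ᴳ ↑) +ᴳ ⋆)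
    × (2 ∣ b → a ≡ 0 → dominationGame (star n) (A ∷ leaves) ≈ᴳ (b ∸ 1) ·ᴳ ↑))
    × (dominationGame (star n) (B ∷ leaves)
    ≈ᴳ -ᴳ dominationGame (star n) (swapColors (star n) (B ∷ leaves)))
theorem6 (suc n) _ a b a+b≡n leaves refl refl =
  ( (λ b<a → value (starGame-b<a b<a))
  , (λ a≤b 1≤a → value (starGame-1≤a≤b a≤b 1≤a))
  , (λ 2∤b a≡0 → value (starGame-odd 2∤b a≡0))
  , (λ 2∣b a≡0 → value (starGame-even 2∣b a≡0)) )
  , ≋⇒≈ᴳ (dominationGame-swapColors (star (suc n)) (B ∷ leaves))
  where
  value : ∀ {V} → starGame a b ≋ V → dominationGame (star (suc n)) (A ∷ leaves) ≈ᴳ V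
  value = ≋⇒≈ᴳ ∘ ≋-trans (dominationGame≋starGame leaves a+b≡n)
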